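{- Let $M$ be an o-minimal structure and let $(A,\tau)$ be an infinite topological space definable in $M$. Then $(A,\tau)$ has weight at most $|A|$.
   Context: O-minimality is understood in the sense of van den Dries' book "Tame Topology and O-minimal Structures": $M$ is an expansion of a dense linear order $(M,<)$ without endpoints such that every subset of $M$ definable with parameters is a finite union of points and open intervals with endpoints in $M\cup\{ -\infty,+\infty\}$. "Definable" means definable in $M$, possibly with parameters from $M$. A topological space $(A,\tau)$ is definable in $M$ when $A\subseteq M^n$ (for some $n$) is a definable set and there exists a definable basis for the topology $\tau$, i.e. a basis of the form $\{\varphi(A;b) : b\in B\}$ for some formula $\varphi(x;y)$ with $|x|=n$ and some definable set $B\subseteq M^{|y|}$, where $\varphi(A;b)=\{a\in A : M\models\varphi(a;b)\}$. The weight of a topological space is the minimum cardinality of a basis for its topology. -}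

module Defs where

open import Level using (Level; _⊔_; suc)
open import Data.Empty.Polymorphic using (⊥)
open import Data.Fin using (Fin)
open import Data.List using (List)
import Data.List.Membership.Propositional as List
open import Data.List.Relation.Unary.Any using (Any)
open import Data.Nat using (ℕ; _+_)
open import Data.Product using (Σ-syntax; ∃; ∃-syntax; _×_; _,_; proj₁)
open import Data.Sum using (_⊎_)
open import Data.Vec using (Vec; []; _∷_; _++_; lookup)
open import Function.Bundles using (_⇔_; Injection; Bijection)
open import Relation.Binary.Bundles using (Setoid)
open import Relation.Binary.Construct.Add.Extrema.Strict using (_<±_)
import Relation.Binary.Construct.On as On
open import Relation.Binary.Core using (Rel)
open import Relation.Binary.PropositionalEquality using (_≡_; setoid)
open import Relation.Binary.Structures using (IsDenseLinearOrder)
open import Relation.Nullary using (¬_)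
open import Relation.Nullary.Construct.Add.Extrema using (_±; [_])
open import Relation.Unary using (Pred; _∈_; _⊆_; _≐_; _∩_; ⋃)
open import Relation.Unary.Relation.Binary.Equality using (≐-setoid)

private
  variable
    s ℓ q c e c′ e′ : Level

-- The symbols of an expansion of an order, other than the order itself:
-- _<_ and equality are atomic formulas of every language.
record Language (s : Level) : Set (suc s) where
  field
    FunSym : ℕ → Set s
    RelSym : ℕ → Set s

module _ (L : Language s) where
  open Language L

  data Term (n : ℕ) : Set s where
    var : Fin n → Term n
    fun : ∀ {k} → FunSym k → Vec (Term n) k → Term n

  -- The bound variable of all′ and ex′ is variable zero of the body.
  data Formula (n : ℕ) : Set s where
    rel           : ∀ {k} → RelSym k → Vec (Term n) k → Formula n
    _=′_ _<′_     : Term n → Term n → Formula n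
    ⊥′            : Formula n
    _∧′_ _∨′_ _⇒′_ : Formula n → Formula n → Formula n
    all′ ex′      : Formula (1 + n) → Formula n

record Structure (L : Language s) (ℓ : Level) : Set (s ⊔ suc ℓ) where
  open Language L using (FunSym; RelSym)
  infix 4 _<_
  field
    Carrier            : Set ℓ
    _<_                : Rel Carrier ℓ
    isDenseLinearOrder : IsDenseLinearOrder _≡_ _<_
    no-least           : ∀ x → ∃[ y ] y < x
    no-greatest        : ∀ x → ∃[ y ] x < y
    funᴹ               : ∀ {k} → FunSym k → Vec Carrier k → Carrier
    relᴹ               : ∀ {k} → RelSym k → Pred (Vec Carrier k) ℓ

module _ {L : Language s} (M : Structure L ℓ) where
  open Structure M

  mutual
    eval : ∀ {n} → Term L n → Vec Carrier n → Carrier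
    eval (var i)    ρ = lookup ρ i
    eval (fun f ts) ρ = funᴹ f (evals ts ρ)

    evals : ∀ {n k} → Vec (Term L n) k → Vec Carrier n → Vec Carrier k
    evals []       ρ = []
    evals (t ∷ ts) ρ = eval t ρ ∷ evals ts ρ

  Sat : ∀ {n} → Formula L n → Pred (Vec Carrier n) ℓ
  Sat (rel R ts) ρ = relᴹ R (evals ts ρ)
  Sat (t =′ u)   ρ = eval t ρ ≡ eval u ρ
  Sat (t <′ u)   ρ = eval t ρ < eval u ρ
  Sat ⊥′         ρ = ⊥
  Sat (φ ∧′ ψ)   ρ = Sat φ ρ × Sat ψ ρ
  Sat (φ ∨′ ψ)   ρ = Sat φ ρ ⊎ Sat ψ ρ
  Sat (φ ⇒′ ψ)   ρ = Sat φ ρ → Sat ψ ρ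
  Sat (all′ φ)   ρ = ∀ x → Sat φ (x ∷ ρ)
  Sat (ex′ φ)    ρ = ∃[ x ] Sat φ (x ∷ ρ)

  Definable : ∀ {n} → Pred (Vec Carrier n) ℓ → Set (s ⊔ ℓ)
  Definable {n} D =
    ∃[ k ] Σ[ φ ∈ Formula L (n + k) ] Σ[ p ∈ Vec Carrier k ]
      (∀ x → x ∈ D ⇔ Sat φ (x ++ p))

  data Piece : Set ℓ where
    point    : Carrier → Piece
    interval : Carrier ± → Carrier ± → Piece

  ⟦_⟧ : Piece → Pred Carrier ℓ
  ⟦ point a ⟧      x = x ≡ a
  ⟦ interval a b ⟧ x = (_<±_ _<_ a [ x ]) × (_<±_ _<_ [ x ] b)

  OMinimal : Set (s ⊔ suc ℓ)
  OMinimal = (D : Pred (Vec Carrier 1) ℓ) → Definable D →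
    Σ[ ps ∈ List Piece ] (∀ x → (x ∷ []) ∈ D ⇔ Any (λ p → x ∈ ⟦ p ⟧) ps)

Infinite : {X : Set ℓ} → Pred X ℓ → Set ℓ
Infinite {X = X} A = ¬ (Σ[ xs ∈ List X ] A ⊆ (List._∈ xs))

-- A topology on the subset A of X, its open sets being subsets of X that are
-- contained in A.  Under excluded middle every subset of the powerset of X can
-- be indexed by a type in Set ℓ (of functions X → Bool), so ⋃-open covers
-- arbitrary unions.
record Topology {X : Set ℓ} (A : Pred X ℓ) : Set (suc ℓ) where
  field
    Open   : Pred (Pred X ℓ) ℓ
    resp   : ∀ {U V} → U ≐ V → Open U → Open V
    open-⊆ : ∀ {U} → Open U → U ⊆ A
    ∅-open : Open (λ _ → ⊥)
    A-open : Open A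
    ∩-open : ∀ {U V} → Open U → Open V → Open (U ∩ V)
    ⋃-open : (I : Set ℓ) (U : I → Pred X ℓ) → (∀ i → Open (U i)) → Open (⋃ I U)

module _ {X : Set ℓ} {A : Pred X ℓ} (τ : Topology A) where
  open Topology τ

  IsBasis : Pred (Pred X ℓ) ℓ → Set (suc ℓ)
  IsBasis 𝓑 = 𝓑 ⊆ Open
            × (∀ {U x} → Open U → x ∈ U → ∃[ V ] V ∈ 𝓑 × x ∈ V × V ⊆ U)

module _ {L : Language s} (M : Structure L ℓ) where
  open Structure M

  family : ∀ {n m} → Pred (Vec Carrier n) ℓ → Formula L (n + m) →
           Pred (Vec Carrier m) ℓ → Pred (Pred (Vec Carrier n) ℓ) ℓ
  family A φ B U = ∃[ b ] b ∈ B × U ≐ (λ a → a ∈ A × Sat M φ (a ++ b))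

  DefinableSpace : ∀ {n} {A : Pred (Vec Carrier n) ℓ} → Topology A → Set (s ⊔ suc ℓ)
  DefinableSpace {n} {A} τ =
    Definable M A ×
    (∃[ m ] Σ[ φ ∈ Formula L (n + m) ] Σ[ B ∈ Pred (Vec Carrier m) ℓ ]
      Definable M B × IsBasis τ (family A φ B))

-- Cardinalities are those of setoids: the elements of a subset are compared
-- without regard to the proof of membership, and subsets extensionally.
Elements : {X : Set ℓ} → Pred X q → Setoid (ℓ ⊔ q) ℓ
Elements {X = X} A = On.setoid {B = ∃ A} (setoid X) proj₁

Members : {X : Set ℓ} → Pred (Pred X ℓ) q → Setoid (suc ℓ ⊔ q) ℓ
Members {ℓ = ℓ} {X = X} 𝓑 = On.setoid {B = ∃ 𝓑} (≐-setoid X ℓ) proj₁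

infix 4 _≼_
_≼_ : Setoid c e → Setoid c′ e′ → Set (c ⊔ e ⊔ c′ ⊔ e′)
S ≼ T = Injection S T

IsWeight : {X : Set ℓ} {A : Pred X ℓ} → Topology A → Setoid c e → Set (suc ℓ ⊔ c ⊔ e)
IsWeight τ κ = (∃[ 𝓑 ] IsBasis τ 𝓑 × Bijection κ (Members 𝓑))
             × (∀ 𝓑 → IsBasis τ 𝓑 → κ ≼ Members 𝓑)

WeightAtMost : {X : Set ℓ} {A : Pred X ℓ} → Topology A → Setoid c e → Set (suc (suc ℓ) ⊔ c ⊔ e)
WeightAtMost {ℓ = ℓ} τ μ = Σ[ κ ∈ Setoid (suc ℓ) ℓ ] IsWeight τ κ × κ ≼ μ

{-# OPTIONS --safe #-}
-- Write D_b ⊆ A for the sets of the definable basis, b ∈ M^m.  If A is infinite,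
-- the family (D_b) has at most |A| members, by induction on m.  Fix all but the
-- last parameter c.  For each a ∈ A the set { c ∣ a ∈ D_{b,c} } has finitely many
-- boundary points, so the c that are a boundary point for some a are determined
-- by b, a and an index i ∈ ℕ.  On an interval of the remaining c the set D_{b,c}
-- is constant, since intervals are definably connected, and the remaining c form
-- a finite union of points and intervals, again indexed by ℕ.  Thus the family is
-- a union of |A| + ℵ₀ definable families over M^(m-1), and its members are named
-- by finite sequences from A and ℕ, of which there are |A| many.
--
-- Excluded middle for all types entails the axiom of choice here; Zorn's lemma
-- gives |A^{<ω}| = |A| and the existence of a basis of least cardinality.
module Submission where

open import Defs
open import Axiom.ExcludedMiddle using (ExcludedMiddle)
open import Axiom.Extensionality.Propositional using (Extensionality)
open import Data.Bool using (Bool; true; false; T)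
open import Data.Bool.Properties using (T-irrelevant)
open import Data.Empty using (⊥-elim)
open import Data.Fin as Fin using (Fin; zero; suc; _↑ˡ_; _↑ʳ_; splitAt)
open import Data.List as List using (List; []; _∷_; concatMap; filter; length; map)
open import Data.List.Membership.Propositional using () renaming (_∈_ to _∈ˡ_; _∉_ to _∉ˡ_)
open import Data.List.Membership.Propositional.Properties using (∈-filter⁺; ∈-map⁺)
open import Data.List.Properties using (filter-notAll; map-injective; ∷-injective; ∷-injectiveˡ; ∷-injectiveʳ)
open import Data.List.Relation.Unary.All as All using (All; []; _∷_)
open import Data.List.Relation.Unary.All.Properties using (++⁻ˡ; ++⁻ʳ) renaming (map⁺ to All-map⁺)
open import Data.List.Relation.Unary.Any as Any using (Any; here; there)
open import Data.Nat as ℕ using (ℕ; zero; suc; _+_; _*_)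
import Data.Nat.Properties as ℕ
open import Data.Product using (∃; Σ-syntax; _×_; _,_; proj₁; proj₂)
open import Data.Product.Function.NonDependent.Propositional using (_×-⇔_)
open import Data.Sum using (_⊎_; inj₁; inj₂; [_,_]′)
open import Data.Sum.Function.Propositional using (_⊎-⇔_)
open import Data.Unit.Polymorphic using (⊤; tt)
open import Data.Vec as Vec using (Vec; []; _∷_; _++_; lookup)
open import Data.Vec.Properties using (lookup-++ˡ; lookup-++ʳ; lookup-splitAt)
open import Function using (_∘_; id; case_of_; _⇔_; mk⇔; Equivalence; Injection)
import Function.Construct.Composition as Composition
import Function.Construct.Identity as Identity
open import Function.Definitions using (Injective)
open import Function.Properties.Equivalence using (⇔-isEquivalence)
open import Function.Related.TypeIsomorphisms using (→-cong-⇔)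
open import Level using (Level; _⊔_; lift; lower)
open import Relation.Binary.Bundles using (Setoid)
open import Relation.Binary.Construct.Add.Extrema.Strict using (_<±_; [_]; ⊥±<[_]; [_]<⊤±)
import Relation.Binary.Construct.Add.Supremum.Strict as Supremum
open import Relation.Binary.Definitions using (tri<; tri≈; tri>)
open import Relation.Binary.PropositionalEquality using (_≡_; _≢_; refl; sym; trans; cong; cong₂; subst)
open import Relation.Binary.Structures using (IsEquivalence; IsDenseLinearOrder)
open import Relation.Nullary using (¬_; Dec; yes; no; contradiction)
open import Relation.Nullary.Construct.Add.Extrema using (_±; [_]; ⊥±; ⊤±)
open import Relation.Nullary.Decidable using (⌊_⌋; toWitness; fromWitness; decidable-stable)
open import Relation.Unary using (Pred)

module _ (EM : ∀ ℓ → ExcludedMiddle ℓ) (FE : ∀ a b → Extensionality a b) where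

  private
    variable
      a p q r : Level

  -- Zorn's lemma and cardinals

  em : {P : Set p} → Dec P
  em = EM _

  ¬∀⇒∃¬ : {X : Set a} {P : X → Set p} → ¬ (∀ x → P x) → ∃ λ x → ¬ P x
  ¬∀⇒∃¬ ¬∀ = decidable-stable em λ ¬∃ → ¬∀ λ x → decidable-stable em λ ¬px → ¬∃ (x , ¬px)

  -- Boolean-valued, so that subsets of `X` and families of them stay in the universe of `X`,
  -- whatever the level of the predicate that `⟨_⟩` turns into one.
  Subset : Set a → Set a
  Subset X = X → Bool

  infix 4 _∈_
  _∈_ : {X : Set a} → X → Subset X → Set
  x ∈ F = T (F x)

  opaque
    ⟨_⟩ : {X : Set a} → Pred X p → Subset X
    ⟨ P ⟩ x = ⌊ em {P = P x} ⌋

    ∈⇒ : {X : Set a} {P : Pred X p} {x : X} → x ∈ ⟨ P ⟩ → P x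
    ∈⇒ = toWitness

    ⇒∈ : {X : Set a} {P : Pred X p} {x : X} → P x → x ∈ ⟨ P ⟩
    ⇒∈ = fromWitness

  module _ {X : Set a} where

    infix 4 _⊑_
    _⊑_ : Subset X → Subset X → Set a
    F ⊑ G = ∀ {x} → x ∈ F → x ∈ G

    T-injective : ∀ {u v} → (T u → T v) → (T v → T u) → u ≡ v
    T-injective {false} {false} f g = refl
    T-injective {false} {true}  f g = ⊥-elim (g _)
    T-injective {true}  {false} f g = ⊥-elim (f _)
    T-injective {true}  {true}  f g = refl

    ⊑-antisym : {F G : Subset X} → F ⊑ G → G ⊑ F → F ≡ G
    ⊑-antisym F⊑G G⊑F = FE _ _ λ x → T-injective F⊑G G⊑F

    ⟨⟩-cong : {P : Pred X p} {Q : Pred X q} → (∀ {x} → P x → Q x) → (∀ {x} → Q x → P x) →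
              ⟨ P ⟩ ≡ ⟨ Q ⟩
    ⟨⟩-cong f g = ⊑-antisym (⇒∈ ∘ f ∘ ∈⇒) (⇒∈ ∘ g ∘ ∈⇒)

    ⋃ˢ : Subset (Subset X) → Subset X
    ⋃ˢ 𝓕 = ⟨ (λ x → ∃ λ F → T (𝓕 F) × x ∈ F) ⟩

    IsChain : Subset (Subset X) → Set a
    IsChain 𝓕 = ∀ {F G} → T (𝓕 F) → T (𝓕 G) → F ⊑ G ⊎ G ⊑ F

  -- The Bourbaki–Witt argument: the stages reached from G₀ by passing to a
  -- larger good set and to unions form a chain, whose union cannot grow.
  module _ {X : Set a} (Good : Pred (Subset X) q)
    (⋃-good : ∀ 𝓕 → ∃ (λ F → T (𝓕 F)) → (∀ {F} → T (𝓕 F) → Good F) → IsChain 𝓕 → Good (⋃ˢ 𝓕))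
    {G₀ : Subset X} (good₀ : Good G₀) where

    private
      -- The decision is an argument so that properties of `next` follow by cases on an arbitrary
      -- decision. Applied to `em` it also makes the choice: the proof of existence supplies `G`.
      enlarge : (F : Subset X) → Dec (∃ λ G → Good G × F ⊑ G × ¬ G ⊑ F) → Subset X
      enlarge F (yes (G , _)) = G
      enlarge F (no _)        = F

      next : Subset X → Subset X
      next F = enlarge F em

      ⊑-next : ∀ F → F ⊑ next F
      ⊑-next F = go em where
        go : ∀ d → F ⊑ enlarge F d
        go (yes (G , _ , F⊑G , _)) = F⊑G
        go (no _)                  = id

      next-good : ∀ F → Good F → Good (next F)
      next-good F good = go em where
        go : ∀ d → Good (enlarge F d)
        go (yes (G , g , _)) = g
        go (no _)            = good

      next⊑⇒maximal : ∀ F → next F ⊑ F → ∀ G → Good G → F ⊑ G → G ⊑ F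
      next⊑⇒maximal F = go em where
        go : ∀ d → enlarge F d ⊑ F → ∀ G → Good G → F ⊑ G → G ⊑ F
        go (yes (G , _ , _ , G⋢F)) G⊑F _ _ _ = contradiction (λ {x} → G⊑F {x}) G⋢F
        go (no ¬∃) _ G g F⊑G = decidable-stable em λ G⋢F → ¬∃ (G , g , F⊑G , G⋢F)

      data Stage : Pred (Subset X) a where
        base : Stage G₀
        step : ∀ {F} → Stage F → Stage (next F)
        -- The union of an empty family would be empty and could fail to contain `G₀`.
        lim  : ∀ 𝓕 → ∃ (λ F → T (𝓕 F)) → (∀ {F} → T (𝓕 F) → Stage F) → Stage (⋃ˢ 𝓕)

      base⊑ : ∀ {F} → Stage F → G₀ ⊑ F
      base⊑ base                          = id
      base⊑ (step {F} s)                  = ⊑-next F ∘ base⊑ s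
      base⊑ (lim 𝓕 (F , F∈𝓕) stages) x∈ = ⇒∈ (F , F∈𝓕 , base⊑ (stages F∈𝓕) x∈)

      -- These are the extreme elements of the Bourbaki-Witt proof. Once all stages are extreme,
      -- `compare` makes any two of them comparable.
      Extreme : Pred (Subset X) a
      Extreme C = ∀ {F} → Stage F → F ⊑ C → ¬ C ⊑ F → next F ⊑ C

      -- Induction on the second stage. A successor of a set properly below `C` stays below `C` by
      -- extremality; a set equal to `C` steps to `next C`.
      compare : ∀ {C} → Stage C → Extreme C → ∀ {F} → Stage F → F ⊑ C ⊎ next C ⊑ F
      compare sC xC base = inj₁ (base⊑ sC)
      compare {C} sC xC (step {F} sF) with compare sC xC sF
      ... | inj₂ nC⊑F = inj₂ (⊑-next F ∘ nC⊑F)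
      ... | inj₁ F⊑C with em {P = C ⊑ F}
      ...   | yes C⊑F = inj₂ (subst (λ D → next C ⊑ next D) (⊑-antisym C⊑F F⊑C) id)
      ...   | no C⋢F  = inj₁ (xC sF F⊑C C⋢F)
      compare {C} sC xC (lim 𝓕 _ stages)
        with em {P = ∃ λ F → T (𝓕 F) × next C ⊑ F}
      ... | yes (F , F∈𝓕 , nC⊑F) = inj₂ λ x∈ → ⇒∈ (F , F∈𝓕 , nC⊑F x∈)
      ... | no ¬∃ = inj₁ λ x∈ → let (F , F∈𝓕 , x∈F) = ∈⇒ x∈ in
        [ (λ F⊑C → F⊑C x∈F) , (λ nC⊑F → contradiction (F , F∈𝓕 , λ {x} → nC⊑F {x}) ¬∃) ]′
          (compare sC xC (stages F∈𝓕))

      extreme : ∀ {C} → Stage C → Extreme C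
      extreme base sF F⊑C C⋢F = contradiction (λ {x} → base⊑ sF {x}) C⋢F
      extreme (step {C} sC) sF F⊑ ⋢F with compare sC (extreme sC) sF
      ... | inj₂ nC⊑F = contradiction (λ {x} → nC⊑F {x}) ⋢F
      ... | inj₁ F⊑C with em {P = C ⊑ _}
      ...   | yes C⊑F = subst (λ D → next D ⊑ next C) (⊑-antisym C⊑F F⊑C) id
      ...   | no C⋢F  = ⊑-next C ∘ extreme sC sF F⊑C C⋢F
      -- Some member `C` of the family is not contained in `F`, as otherwise the whole union would
      -- be. The extremality of that `C` bounds `next F`.
      extreme (lim 𝓕 _ stages) {F} sF F⊑ ⋢F x∈
        with em {P = ∃ λ C → T (𝓕 C) × ¬ C ⊑ F}
      ... | no ¬∃ = ⊥-elim (⋢F λ y∈ → let (C , C∈𝓕 , y∈C) = ∈⇒ y∈ in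
              decidable-stable em λ y∉F → ¬∃ (C , C∈𝓕 , λ C⊑F → y∉F (C⊑F y∈C)))
      ... | yes (C , C∈𝓕 , C⋢F) with compare (stages C∈𝓕) (extreme (stages C∈𝓕)) sF
      ...   | inj₁ F⊑C  = ⇒∈ (C , C∈𝓕 , extreme (stages C∈𝓕) sF F⊑C C⋢F x∈)
      ...   | inj₂ nC⊑F = contradiction (λ {x} → nC⊑F {x} ∘ ⊑-next C) C⋢F

      stages-chain : ∀ {F G} → Stage F → Stage G → F ⊑ G ⊎ G ⊑ F
      stages-chain {F} sF sG with compare sF (extreme sF) sG
      ... | inj₁ G⊑F  = inj₂ G⊑F
      ... | inj₂ nF⊑G = inj₁ (nF⊑G ∘ ⊑-next F)

      stage-good : ∀ {F} → Stage F → Good F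
      stage-good base                  = good₀
      stage-good (step {F} s)          = next-good F (stage-good s)
      stage-good (lim 𝓕 ne stages) =
        ⋃-good 𝓕 ne (λ F∈ → stage-good (stages F∈)) λ F∈ G∈ → stages-chain (stages F∈) (stages G∈)

      -- The stages themselves form a family of the kind that `lim` accepts. As the successor of
      -- their union is again a stage, it is contained in that union.
      top : Stage (⋃ˢ ⟨ Stage ⟩)
      top = lim ⟨ Stage ⟩ (G₀ , ⇒∈ base) ∈⇒

    zorn : ∃ λ F → Good F × G₀ ⊑ F × (∀ G → Good G → F ⊑ G → G ⊑ F)
    zorn = ⋃ˢ ⟨ Stage ⟩ , stage-good top , base⊑ top ,
      next⊑⇒maximal _ λ x∈ → ⇒∈ (_ , ⇒∈ (step top) , x∈)

  -- Hönig's proof: a maximal set of points of the product on which all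
  -- projections are injective has a surjective projection.
  module _ {I : Set a} (i₀ : I) (S : I → Setoid p r) where

    open module S i = Setoid (S i) using () renaming (Carrier to ∣S∣_; _≈_ to ≈S)

    private
      Π : Set (a ⊔ p)
      Π = ∀ i → ∣S∣ i

      Good : Pred (Subset Π) (a ⊔ p ⊔ r)
      Good F = ∀ {f g} → f ∈ F → g ∈ F → ∀ i j → ≈S i (f i) (g i) → ≈S j (f j) (g j)

      ⋃-good : ∀ 𝓕 → ∃ (λ F → T (𝓕 F)) → (∀ {F} → T (𝓕 F) → Good F) → IsChain 𝓕 → Good (⋃ˢ 𝓕)
      ⋃-good 𝓕 _ good chain f∈ g∈ with ∈⇒ f∈ | ∈⇒ g∈
      ... | F , F∈ , f∈F | G , G∈ , g∈G with chain F∈ G∈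
      ...   | inj₁ F⊑G = good G∈ (F⊑G f∈F) g∈G
      ...   | inj₂ G⊑F = good F∈ f∈F (G⊑F g∈G)

    least-cardinal : ∃ λ i → ∀ j → S i ≼ S j
    least-cardinal with zorn Good ⋃-good {λ _ → false} (λ ())
    ... | F , good , _ , max with em {P = ∃ λ i → ∀ x → ∃ λ f → f ∈ F × ≈S i (f i) x}
    -- The injection lifts `x` along the surjective projection to `i` and then projects to `j`;
    -- goodness of `F` makes this well defined and injective.
    ...   | yes (i , onto) = i , λ j → record
      { to        = λ x → proj₁ (onto x) j
      ; cong      = λ {x} {y} x≈y → let (f , f∈ , fx) = onto x ; (g , g∈ , gy) = onto y in
                      good f∈ g∈ i j (S.trans i fx (S.trans i x≈y (S.sym i gy)))
      ; injective = λ {x} {y} fg → let (f , f∈ , fx) = onto x ; (g , g∈ , gy) = onto y in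
                      S.trans i (S.sym i fx) (S.trans i (good f∈ g∈ j i fg) gy)
      }
    -- Each projection misses a value, and the missed values form a point `f`. Adding `f` keeps all
    -- projections injective, so `f` is in `F` by maximality and attains the value missed at `i₀`.
    ...   | no ¬onto = contradiction (f , f∈F , S.refl i₀) (proj₂ (missed i₀))
      where
      missed : ∀ i → ∃ λ x → ¬ ∃ λ f → f ∈ F × ≈S i (f i) x
      missed i = ¬∀⇒∃¬ λ onto → ¬onto (i , onto)

      f : Π
      f i = proj₁ (missed i)

      good⁺ : Good ⟨ (λ g → g ∈ F ⊎ g ≡ f) ⟩
      good⁺ g∈ h∈ i j with ∈⇒ g∈ | ∈⇒ h∈
      ... | inj₁ g∈F  | inj₁ h∈F  = good g∈F h∈F i j
      ... | inj₁ g∈F  | inj₂ refl = λ gf → contradiction (_ , g∈F , gf) (proj₂ (missed i))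
      ... | inj₂ refl | inj₁ h∈F  = λ fh → contradiction (_ , h∈F , S.sym i fh) (proj₂ (missed i))
      ... | inj₂ refl | inj₂ refl = λ _ → S.refl j

      f∈F : f ∈ F
      f∈F = max _ good⁺ (⇒∈ ∘ inj₁) (⇒∈ (inj₂ refl))

  ≼-total : (S T : Setoid p r) → S ≼ T ⊎ T ≼ S
  ≼-total S T with least-cardinal true (λ { true → S ; false → T })
  ... | true  , le = inj₁ (le false)
  ... | false , le = inj₂ (le true)

  -- Lists over an infinite set

  pair : ℕ → ℕ → ℕ
  pair zero    n = suc (2 * n)
  pair (suc m) n = 2 * pair m n

  -- By parity, since `pair m n` is 2^m (2n + 1).
  pair-injective : ∀ m n m′ n′ → pair m n ≡ pair m′ n′ → m ≡ m′ × n ≡ n′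
  pair-injective zero    n zero     n′ eq = refl , ℕ.*-cancelˡ-≡ n n′ 2 (ℕ.suc-injective eq)
  pair-injective zero    n (suc m′) n′ eq = contradiction (sym eq) (ℕ.even≢odd (pair m′ n′) n)
  pair-injective (suc m) n zero     n′ eq = contradiction eq (ℕ.even≢odd (pair m n) n′)
  pair-injective (suc m) n (suc m′) n′ eq =
    let eqm , eqn = pair-injective m n m′ n′ (ℕ.*-cancelˡ-≡ (pair m n) (pair m′ n′) 2 eq)
    in cong suc eqm , eqn

  encode : List ℕ → ℕ
  encode []       = 0
  encode (n ∷ ns) = suc (pair n (encode ns))

  encode-injective : Injective _≡_ _≡_ encode
  encode-injective {[]}     {[]}     eq = refl
  encode-injective {n ∷ ns} {m ∷ ms} eq =
    let eqm , eqn = pair-injective n _ m _ (ℕ.suc-injective eq) in cong₂ _∷_ eqm (encode-injective eqn)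

  -- A maximal injection List X → X with X ⊆ A, represented by its graph, has
  -- |A ∖ X| ≤ |X|, as otherwise it extends to the union of X with a disjoint copy.
  module _ {A : Set a} (ν : ℕ → A) (ν-injective : Injective _≡_ _≡_ ν) where

    private
      Graph : Set a
      Graph = Subset (List A × A)

      -- The set X is read off from the graph by its one-element lists, so that a graph alone
      -- carries all the data and Zorn's lemma applies to subsets.
      Supp : Graph → Pred A a
      Supp G x = ∃ λ y → (x ∷ [] , y) ∈ G

      record Good (G : Graph) : Set a where
        field
          functional : ∀ {l y y′} → (l , y) ∈ G → (l , y′) ∈ G → y ≡ y′
          injective  : ∀ {l l′ y} → (l , y) ∈ G → (l′ , y) ∈ G → l ≡ l′
          domain     : ∀ {l y} → (l , y) ∈ G → All (Supp G) l
          total      : ∀ {l} → All (Supp G) l → ∃ λ y → (l , y) ∈ G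
          range      : ∀ {l y} → (l , y) ∈ G → Supp G y

      Supp-mono : ∀ G H → G ⊑ H → ∀ {x} → Supp G x → Supp H x
      Supp-mono _ _ G⊑H (y , xy∈) = y , G⊑H xy∈

      ⋃-good : ∀ 𝓕 → ∃ (λ F → T (𝓕 F)) → (∀ {F} → T (𝓕 F) → Good F) → IsChain 𝓕 → Good (⋃ˢ 𝓕)
      ⋃-good 𝓕 (F₀ , F₀∈) good chain = record
        { functional = λ ly∈ ly′∈ →
            let _ , F∈ , ly∈F , ly′∈F = common (∈⇒ ly∈) (∈⇒ ly′∈)
            in Good.functional (good F∈) ly∈F ly′∈F
        ; injective = λ ly∈ l′y∈ →
            let _ , F∈ , ly∈F , l′y∈F = common (∈⇒ ly∈) (∈⇒ l′y∈)
            in Good.injective (good F∈) ly∈F l′y∈F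
        ; domain = λ ly∈ →
            let F , F∈ , ly∈F = ∈⇒ ly∈
            in All.map (Supp-mono F (⋃ˢ 𝓕) (member⊑ F∈)) (Good.domain (good F∈) ly∈F)
        ; total = λ sl →
            let _ , F∈ , slF = collect sl ; y , ly∈F = Good.total (good F∈) slF
            in y , member⊑ F∈ ly∈F
        ; range = λ ly∈ →
            let F , F∈ , ly∈F = ∈⇒ ly∈ in Supp-mono F (⋃ˢ 𝓕) (member⊑ F∈) (Good.range (good F∈) ly∈F)
        }
        where
        member⊑ : ∀ {F} → T (𝓕 F) → F ⊑ ⋃ˢ 𝓕
        member⊑ F∈ x∈F = ⇒∈ (_ , F∈ , x∈F)

        common : ∀ {u v} → ∃ (λ F → T (𝓕 F) × u ∈ F) → ∃ (λ F → T (𝓕 F) × v ∈ F) →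
                 ∃ λ F → T (𝓕 F) × u ∈ F × v ∈ F
        common (F , F∈ , u∈) (G , G∈ , v∈) with chain F∈ G∈
        ... | inj₁ F⊑G = G , G∈ , F⊑G u∈ , v∈
        ... | inj₂ G⊑F = F , F∈ , u∈ , G⊑F v∈

        -- A list has finitely many entries, so the chain condition yields one member of `𝓕` that
        -- supports them all. The empty list falls back on `F₀`.
        collect : ∀ {l} → All (Supp (⋃ˢ 𝓕)) l → ∃ λ F → T (𝓕 F) × All (Supp F) l
        collect [] = F₀ , F₀∈ , []
        collect ((y , xy∈) ∷ ss) with ∈⇒ xy∈ | collect ss
        ... | F , F∈ , xy∈F | G , G∈ , ssG with chain F∈ G∈
        ...   | inj₁ F⊑G = G , G∈ , (y , F⊑G xy∈F) ∷ ssG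
        ...   | inj₂ G⊑F = F , F∈ , (y , xy∈F) ∷ All.map (Supp-mono G F G⊑F) ssG

      -- The starting injection, whose X is the range of `ν`.
      Base : List A → A → Set a
      Base l y = ∃ λ ns → l ≡ map ν ns × y ≡ ν (encode ns)

      G₀ : Graph
      G₀ = ⟨ (λ (l , y) → Base l y) ⟩

      supp₀ : ∀ n → Supp G₀ (ν n)
      supp₀ n = _ , ⇒∈ (n ∷ [] , refl , refl)

      good₀ : Good G₀
      good₀ = record
        { functional = λ ly∈ ly′∈ → functional (∈⇒ ly∈) (∈⇒ ly′∈)
        ; injective  = λ ly∈ l′y∈ → injective (∈⇒ ly∈) (∈⇒ l′y∈)
        ; domain     = λ ly∈ → domain (∈⇒ ly∈)
        ; total      = λ sl → let ns , l≡ = names sl in _ , ⇒∈ (ns , l≡ , refl)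
        ; range      = λ ly∈ → range (∈⇒ ly∈)
        }
        where
        functional : ∀ {l y y′} → Base l y → Base l y′ → y ≡ y′
        functional (ns , refl , refl) (ms , eq , refl) =
          cong (ν ∘ encode) (map-injective ν-injective eq)

        injective : ∀ {l l′ y} → Base l y → Base l′ y → l ≡ l′
        injective (ns , refl , refl) (ms , refl , eq) =
          cong (map ν) (encode-injective (ν-injective eq))

        domain : ∀ {l y} → Base l y → All (Supp G₀) l
        domain (ns , refl , _) = All-map⁺ (All.universal supp₀ ns)

        range : ∀ {l y} → Base l y → Supp G₀ y
        range (ns , _ , refl) = supp₀ (encode ns)

        name : ∀ {x} → Supp G₀ x → ∃ λ n → x ≡ ν n
        name (_ , xy∈) with ∈⇒ xy∈
        ... | n ∷ [] , refl , _ = n , refl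

        names : ∀ {l} → All (Supp G₀) l → ∃ λ ns → l ≡ map ν ns
        names []       = [] , refl
        names (s ∷ ss) = let n , x≡ = name s ; ns , l≡ = names ss in n ∷ ns , cong₂ _∷_ x≡ l≡

      -- R is an injection from some of the points outside X to X.  Coding w ∈ X by
      -- [ w ] and w ∉ X with R w x by [ x , x ] embeds List W into List X, hence into X.
      module Encoding {G : Graph} (good : Good G) (R : A → A → Set a)
        (R-injective : ∀ {w w′ x} → R w x → R w′ x → w ≡ w′) where
        open Good good

        X = Supp G

        Rel : Pred A a
        Rel w = ∃ λ x → X x × R w x

        W : Pred A a
        W w = X w ⊎ Rel w

        value : ∀ {l} → Dec (∃ λ y → (l , y) ∈ G) → A
        value (yes (y , _)) = y
        -- Not reached on lists over `X`, to which `total` gives a value.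
        value (no _)        = ν 0

        g : List A → A
        g l = value {l} em

        g-spec : ∀ {l} → All X l → (l , g l) ∈ G
        g-spec {l} sl = go em where
          go : ∀ d → (l , value {l} d) ∈ G
          go (yes (_ , ly∈)) = ly∈
          go (no ¬ly)        = contradiction (total sl) ¬ly

        g-injective : ∀ {l l′} → All X l → All X l′ → g l ≡ g l′ → l ≡ l′
        g-injective {l} sl sl′ eq =
          injective (g-spec sl) (subst (λ y → (_ , y) ∈ G) (sym eq) (g-spec sl′))

        tag : ∀ w → Dec (X w) → Dec (Rel w) → List A
        tag w (yes _) _             = w ∷ []
        tag w (no _)  (yes (x , _)) = x ∷ x ∷ []
        -- Only points outside `W` get the empty list. It makes `tag` total, so that `code` has
        -- values in `X` at every point.
        tag w (no _)  (no _)        = []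

        tag-supp : ∀ {w} d d′ → All X (tag w d d′)
        tag-supp (yes xw) _                  = xw ∷ []
        tag-supp (no _)   (yes (x , xx , _)) = xx ∷ xx ∷ []
        tag-supp (no _)   (no _)             = []

        tag-injective : ∀ {w w′} → W w → W w′ → ∀ d₁ d₂ d₁′ d₂′ →
                        tag w d₁ d₂ ≡ tag w′ d₁′ d₂′ → w ≡ w′
        tag-injective _ _ (yes _) _ (yes _) _ refl = refl
        tag-injective _ _ (yes _) _ (no _) (yes _) ()
        tag-injective _ _ (yes _) _ (no _) (no _)  ()
        tag-injective _ _ (no _) (yes _) (yes _) _ ()
        tag-injective _ _ (no _) (no _)  (yes _) _ ()
        tag-injective _ _ (no _) (yes (_ , _ , r)) (no _) (yes (_ , _ , r′)) refl = R-injective r r′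
        tag-injective w∈ _ (no ¬x) (no ¬r) _ _ _ = contradiction w∈ [ ¬x , ¬r ]′
        tag-injective _ w∈ _ _ (no ¬x) (no ¬r) _ = contradiction w∈ [ ¬x , ¬r ]′

        code : A → A
        code w = g (tag w em em)

        code-supp : ∀ w → X (code w)
        code-supp w = range (g-spec (tag-supp em em))

        code-injective : ∀ {w w′} → W w → W w′ → code w ≡ code w′ → w ≡ w′
        code-injective ww ww′ eq =
          tag-injective ww ww′ em em em em (g-injective (tag-supp em em) (tag-supp em em) eq)

        codes-injective : ∀ {l l′} → All W l → All W l′ → map code l ≡ map code l′ → l ≡ l′
        codes-injective []       []         _  = refl
        codes-injective (w ∷ ws) (w′ ∷ ws′) eq =
          cong₂ _∷_ (code-injective w w′ (∷-injectiveˡ eq)) (codes-injective ws ws′ (∷-injectiveʳ eq))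

        codes-supp : ∀ l → All X (map code l)
        codes-supp l = All-map⁺ (All.universal code-supp l)

        κ : List A → A
        κ l = g (map code l)

        κ-supp : ∀ l → X (κ l)
        κ-supp l = range (g-spec (codes-supp l))

        κ-injective : ∀ {l l′} → All W l → All W l′ → κ l ≡ κ l′ → l ≡ l′
        κ-injective {l} {l′} wl wl′ eq =
          codes-injective wl wl′ (g-injective (codes-supp l) (codes-supp l′) eq)

    List-embeds : ∃ λ (f : List A → A) → Injective _≡_ _≡_ f
    List-embeds with zorn Good ⋃-good good₀
    ... | G , good , G₀⊑G , max with ≼-total (Elements (λ x → ¬ Supp G x)) (Elements (Supp G))
    -- With `h` as the relation `R`, the set `W` is all of `A`, so `κ` is injective on all lists.
    ...   | inj₁ h = κ , κ-injective (All.universal all-W _) (All.universal all-W _)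
      where
      R : A → A → Set a
      R w x = ∃ λ ¬xw → proj₁ (Injection.to h (w , ¬xw)) ≡ x

      R-injective : ∀ {w w′ x} → R w x → R w′ x → w ≡ w′
      R-injective (_ , refl) (_ , eq) = sym (Injection.injective h eq)

      open Encoding good R R-injective

      all-W : ∀ w → W w
      all-W w with em {P = X w}
      ... | yes xw = inj₁ xw
      ... | no ¬xw = inj₂ (_ , proj₂ (Injection.to h (w , ¬xw)) , ¬xw , refl)
    -- By maximality `G⁺` is contained in `G`, so the image under `h` of the point `ν 0` of `X`
    -- would lie in `X`, although `h` maps into the complement.
    ...   | inj₂ h = contradiction
      (Supp-mono G⁺ G (max G⁺ good⁺ (⇒∈ ∘ inj₁)) (supp⁺ (inj₂ (_ , x₀ , x₀ , refl)))) (new x₀)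
      where
      new : ∀ {x} (sx : Supp G x) → ¬ Supp G (proj₁ (Injection.to h (x , sx)))
      new sx = proj₂ (Injection.to h (_ , sx))

      R : A → A → Set a
      R w x = ∃ λ xx → proj₁ (Injection.to h (x , xx)) ≡ w

      R-injective : ∀ {w w′ x} → R w x → R w′ x → w ≡ w′
      R-injective (_ , refl) (_ , refl) = Injection.cong h refl

      open Encoding good R R-injective

      x₀ : X (ν 0)
      x₀ = Supp-mono G₀ G G₀⊑G (supp₀ 0)

      -- The new lists are coded in `X` by `κ` and moved by `h` into the disjoint copy, so their
      -- values cannot meet those of `G`.
      New : List A → A → Set a
      New l y = All W l × ¬ All X l × ∃ λ xκ → y ≡ proj₁ (Injection.to h (κ l , xκ))

      G⁺ : Graph
      G⁺ = ⟨ (λ (l , y) → (l , y) ∈ G ⊎ New l y) ⟩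

      supp⁺ : ∀ {w} → W w → Supp G⁺ w
      supp⁺ {w} ww with em {P = X w}
      ... | yes (y , wy∈) = y , ⇒∈ (inj₁ wy∈)
      ... | no ¬xw = _ , ⇒∈ (inj₂ (ww ∷ [] , (λ { (xw ∷ []) → ¬xw xw }) , κ-supp (w ∷ []) , refl))

      old-or-new : ∀ {w} → Supp G⁺ w → W w
      old-or-new (y , wy∈) with ∈⇒ wy∈
      ... | inj₁ wy∈G          = inj₁ (y , wy∈G)
      ... | inj₂ (ww ∷ [] , _) = ww

      good⁺ : Good G⁺
      good⁺ = record
        { functional = λ ly∈ ly′∈ → functional⁺ (∈⇒ ly∈) (∈⇒ ly′∈)
        ; injective  = λ ly∈ l′y∈ → injective⁺ (∈⇒ ly∈) (∈⇒ l′y∈)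
        ; domain     = λ ly∈ → domain⁺ (∈⇒ ly∈)
        ; total      = λ sl → total⁺ (All.map old-or-new sl)
        ; range      = λ ly∈ → range⁺ (∈⇒ ly∈)
        }
        where
        open Good good

        functional⁺ : ∀ {l y y′} → (l , y) ∈ G ⊎ New l y → (l , y′) ∈ G ⊎ New l y′ → y ≡ y′
        functional⁺ (inj₁ ly) (inj₁ ly′) = functional ly ly′
        functional⁺ (inj₁ ly) (inj₂ (_ , ¬xl , _)) = contradiction (domain ly) ¬xl
        functional⁺ (inj₂ (_ , ¬xl , _)) (inj₁ ly′) = contradiction (domain ly′) ¬xl
        functional⁺ (inj₂ (_ , _ , _ , refl)) (inj₂ (_ , _ , _ , refl)) = Injection.cong h refl

        injective⁺ : ∀ {l l′ y} → (l , y) ∈ G ⊎ New l y → (l′ , y) ∈ G ⊎ New l′ y → l ≡ l′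
        injective⁺ (inj₁ ly) (inj₁ l′y) = injective ly l′y
        injective⁺ (inj₁ ly) (inj₂ (_ , _ , xκ , refl)) = contradiction (range ly) (new xκ)
        injective⁺ (inj₂ (_ , _ , xκ , refl)) (inj₁ l′y) = contradiction (range l′y) (new xκ)
        injective⁺ (inj₂ (wl , _ , _ , refl)) (inj₂ (wl′ , _ , _ , eq)) =
          κ-injective wl wl′ (Injection.injective h eq)

        domain⁺ : ∀ {l y} → (l , y) ∈ G ⊎ New l y → All (Supp G⁺) l
        domain⁺ (inj₁ ly)       = All.map (supp⁺ ∘ inj₁) (domain ly)
        domain⁺ (inj₂ (wl , _)) = All.map supp⁺ wl

        total⁺ : ∀ {l} → All W l → ∃ λ y → (l , y) ∈ G⁺
        total⁺ {l} wl with em {P = All X l}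
        ... | yes xl = let y , ly∈ = total xl in y , ⇒∈ (inj₁ ly∈)
        ... | no ¬xl = _ , ⇒∈ (inj₂ (wl , ¬xl , κ-supp l , refl))

        range⁺ : ∀ {l y} → (l , y) ∈ G ⊎ New l y → Supp G⁺ y
        range⁺ (inj₁ ly)                    = supp⁺ (inj₁ (range ly))
        range⁺ (inj₂ (_ , _ , xκ , refl)) = supp⁺ (inj₂ (_ , xκ , xκ , refl))

  -- Definable predicates

  module ⇔ {ℓ} = IsEquivalence (⇔-isEquivalence {ℓ})

  module _ {s} {L : Language s} where

    private
      variable
        m n k : ℕ

    mutual
      renameᵗ : (Fin m → Fin n) → Term L m → Term L n
      renameᵗ σ (var i)    = var (σ i)
      renameᵗ σ (fun f ts) = fun f (renameᵗˢ σ ts)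

      renameᵗˢ : (Fin m → Fin n) → Vec (Term L m) k → Vec (Term L n) k
      renameᵗˢ σ []       = []
      renameᵗˢ σ (t ∷ ts) = renameᵗ σ t ∷ renameᵗˢ σ ts

    rename : (Fin m → Fin n) → Formula L m → Formula L n
    rename σ (rel R ts) = rel R (renameᵗˢ σ ts)
    rename σ (t =′ u)   = renameᵗ σ t =′ renameᵗ σ u
    rename σ (t <′ u)   = renameᵗ σ t <′ renameᵗ σ u
    rename σ ⊥′         = ⊥′
    rename σ (φ ∧′ ψ)   = rename σ φ ∧′ rename σ ψ
    rename σ (φ ∨′ ψ)   = rename σ φ ∨′ rename σ ψ
    rename σ (φ ⇒′ ψ)   = rename σ φ ⇒′ rename σ ψ
    rename σ (all′ φ)   = all′ (rename (Fin.lift 1 σ) φ)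
    rename σ (ex′ φ)    = ex′ (rename (Fin.lift 1 σ) φ)

  module Definability {s ℓ} {L : Language s} (M : Structure L ℓ) where
    open Structure M using (_<_) renaming (Carrier to C)

    private
      variable
        x y : Level
        X : Set x
        Y : Set y
        k l m n : ℕ

      Renames : (Fin m → Fin n) → Vec C n → Vec C m → Set ℓ
      Renames σ v w = ∀ i → lookup v (σ i) ≡ lookup w i

      lift-renames : ∀ {σ : Fin m → Fin n} {v w} → Renames σ v w →
                     ∀ c → Renames (Fin.lift 1 σ) (c ∷ v) (c ∷ w)
      lift-renames r c zero    = refl
      lift-renames r c (suc i) = r i

      mutual
        eval-rename : ∀ {σ : Fin m → Fin n} {v w} → Renames σ v w →
                      ∀ t → eval M (renameᵗ σ t) v ≡ eval M t w
        eval-rename r (var i)    = r i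
        eval-rename r (fun f ts) = cong (Structure.funᴹ M f) (evals-rename r ts)

        evals-rename : ∀ {σ : Fin m → Fin n} {v w} → Renames σ v w →
                       ∀ (ts : Vec (Term L m) k) → evals M (renameᵗˢ σ ts) v ≡ evals M ts w
        evals-rename r []       = refl
        evals-rename r (t ∷ ts) = cong₂ _∷_ (eval-rename r t) (evals-rename r ts)

      Sat-rename : ∀ {σ : Fin m → Fin n} {v w} → Renames σ v w →
                   ∀ φ → Sat M (rename σ φ) v ⇔ Sat M φ w
      Sat-rename r (rel R ts) = ⇔.reflexive (cong (Structure.relᴹ M R) (evals-rename r ts))
      Sat-rename r (t =′ u)   = ⇔.reflexive (cong₂ _≡_ (eval-rename r t) (eval-rename r u))
      Sat-rename r (t <′ u)   = ⇔.reflexive (cong₂ _<_ (eval-rename r t) (eval-rename r u))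
      Sat-rename r ⊥′         = ⇔.refl
      Sat-rename r (φ ∧′ ψ)   = Sat-rename r φ ×-⇔ Sat-rename r ψ
      Sat-rename r (φ ∨′ ψ)   = Sat-rename r φ ⊎-⇔ Sat-rename r ψ
      Sat-rename r (φ ⇒′ ψ)   = →-cong-⇔ (Sat-rename r φ) (Sat-rename r ψ)
      Sat-rename r (all′ φ)   = mk⇔
        (λ f c → Equivalence.to (Sat-rename (lift-renames r c) φ) (f c))
        (λ f c → Equivalence.from (Sat-rename (lift-renames r c) φ) (f c))
      Sat-rename r (ex′ φ)    = mk⇔
        (λ (c , p) → c , Equivalence.to (Sat-rename (lift-renames r c) φ) p)
        (λ (c , p) → c , Equivalence.from (Sat-rename (lift-renames r c) φ) p)

    -- A context lets predicates on any type X be definable: each x : X assigns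
    -- values to n variables, and parameters from M are kept out of sight in Def.
    Context : Set x → ℕ → Set _
    Context X n = X → Vec C n

    record Var {X : Set x} (e : Context X n) (t : X → C) : Set (x ⊔ ℓ) where
      constructor variable′
      field
        index  : Fin n
        lookup≡ : ∀ x → lookup (e x) index ≡ t x
    open Var public

    record Vars {X : Set x} (e : Context X n) (h : X → Vec C k) : Set (x ⊔ ℓ) where
      constructor variables
      field coordinate : ∀ i → Var e (λ x → lookup (h x) i)
    open Vars public

    record Def {X : Set x} (e : Context X n) (P : X → Set ℓ) : Set (s ⊔ x ⊔ ℓ) where
      constructor definable
      field
        {arity}    : ℕ
        formula    : Formula L (n + arity)
        parameters : Vec C arity
        sat⇔       : ∀ x → P x ⇔ Sat M formula (e x ++ parameters)

    infixl 5 _▸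
    -- The new value comes first because variable zero is the one bound by `ex′` and `all′`;
    -- quantifiers then need no renaming.
    _▸ : Context X n → Context (X × C) (suc n)
    (e ▸) (x , c) = c ∷ e x

    private
      variable
        e f : Context X n
        t u : X → C
        h : X → Vec C k

    newest : Var (e ▸) proj₂
    newest = variable′ zero λ _ → refl

    older : Var e t → Var (e ▸) (t ∘ proj₁)
    older (variable′ i eq) = variable′ (suc i) (eq ∘ proj₁)

    olders : Vars e h → Vars (e ▸) (h ∘ proj₁)
    olders vs = variables (older ∘ coordinate vs)

    all-vars : {e : Context X n} → Vars e e
    all-vars = variables λ i → variable′ i λ _ → refl

    infixr 5 _∷ᵛ_ _++ᵛ_
    _∷ᵛ_ : Var e t → Vars e h → Vars e (λ x → t x ∷ h x)
    v ∷ᵛ vs = variables λ { zero → v ; (suc i) → coordinate vs i }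

    _++ᵛ_ : {h : X → Vec C k} {h′ : X → Vec C l} →
            Vars e h → Vars e h′ → Vars e (λ x → h x ++ h′ x)
    _++ᵛ_ {X = X} {k = k} {e = e} {h = h} {h′} vs ws = variables λ i →
      let v = choose (splitAt k i) in
      variable′ (index v) λ x → trans (lookup≡ v x) (sym (lookup-splitAt k (h x) (h′ x) i))
      where
      choose : ∀ s → Var e (λ x → [ lookup (h x) , lookup (h′ x) ]′ s)
      choose (inj₁ i) = coordinate vs i
      choose (inj₂ i) = coordinate ws i

    leftᵛ : {f : Context X m} → Vars e h → Vars (λ x → e x ++ f x) h
    leftᵛ {m = m} {e = e} {f = f} vs = variables λ i → let variable′ j eq = coordinate vs i in
      variable′ (j ↑ˡ m) λ x → trans (lookup-++ˡ (e x) (f x) j) (eq x)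

    rightᵛ : {e : Context X n} → Vars f h → Vars (λ x → e x ++ f x) h
    rightᵛ {n = n} {f = f} {e = e} vs = variables λ i → let variable′ j eq = coordinate vs i in
      variable′ (n ↑ʳ j) λ x → trans (lookup-++ʳ (e x) (f x) j) (eq x)

    transᵛ : {f : Context X k} → Vars e f → Vars f h → Vars e h
    transᵛ vs ws = variables λ i →
      let variable′ j eq = coordinate ws i ; variable′ j′ eq′ = coordinate vs j in
      variable′ j′ λ x → trans (eq′ x) (eq x)

    Sat-vars : {X : Set x} {e : Context X n} {h : X → Vec C k} → Vars e h → (φ : Formula L k) →
               Σ[ ψ ∈ Formula L n ] (∀ x → Sat M φ (h x) ⇔ Sat M ψ (e x))
    Sat-vars vs φ = rename (index ∘ coordinate vs) φ ,
      λ x → ⇔.sym (Sat-rename (λ i → lookup≡ (coordinate vs i) x) φ)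

    Def-cong : {P Q : X → Set ℓ} → (∀ x → Q x ⇔ P x) → Def e P → Def e Q
    Def-cong Q⇔P (definable φ p sat) = definable φ p λ x → ⇔.trans (Q⇔P x) (sat x)

    private
      module _ {X : Set x} (e : Context X n) (p : Vec C k) (q : Vec C l) where
        params : Vars (λ x → e x ++ p ++ q) (λ _ → p ++ q)
        params = rightᵛ {e = e} (all-vars {e = λ _ → p ++ q})

        paramsˡ : Vars (λ x → e x ++ p ++ q) (λ x → e x ++ p)
        paramsˡ = leftᵛ (all-vars {e = e}) ++ᵛ transᵛ params (leftᵛ (all-vars {e = λ _ → p}))

        paramsʳ : Vars (λ x → e x ++ p ++ q) (λ _ → q)
        paramsʳ = transᵛ params (rightᵛ (all-vars {e = λ _ → q}))

    -- Arguments of `P` may be variables of `e` or fixed elements of `M`; the latter are listed in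
    -- `q` and join the parameters.
    Def-specialise : {P : Y → Set ℓ} {f : Context Y m} {g : X → Y} (q : Vec C k) →
                     Vars (λ x → e x ++ q) (f ∘ g) → Def f P → Def e (P ∘ g)
    Def-specialise {e = e} {g = g} q vs (definable φ p sat) =
      let ψ , eq = Sat-vars
            (transᵛ (paramsˡ e q p) vs ++ᵛ paramsʳ e q p) φ
      in definable ψ (q ++ p) λ x → ⇔.trans (sat (g x)) (eq x)

    Def-reindex : {P : Y → Set ℓ} {f : Context Y m} {g : X → Y} →
                  Vars e (f ∘ g) → Def f P → Def e (P ∘ g)
    Def-reindex vs = Def-specialise [] (leftᵛ vs)

    Def-< : Var e t → Var e u → Def e (λ x → t x < u x)
    Def-< {e = e} {t = t} {u = u} v w = definable (var (index v′) <′ var (index w′)) [] λ x →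
      ⇔.reflexive (sym (cong₂ _<_ (lookup≡ v′ x) (lookup≡ w′ x)))
      where
      vs : Vars (λ x → e x ++ []) (λ x → t x ∷ u x ∷ [])
      vs = leftᵛ (v ∷ᵛ w ∷ᵛ variables λ ())
      v′ = coordinate vs zero
      w′ = coordinate vs (suc zero)

    private
      -- Each formula has parameters of its own, so both are renamed to read them from `p ++ q`.
      Def-binary : {_⋆_ : Set ℓ → Set ℓ → Set ℓ}
        (_⋆′_ : ∀ {n} → Formula L n → Formula L n → Formula L n) →
        (∀ {n} {P Q : Set ℓ} {φ ψ : Formula L n} {v} →
          P ⇔ Sat M φ v → Q ⇔ Sat M ψ v → (P ⋆ Q) ⇔ Sat M (φ ⋆′ ψ) v) →
        {P Q : X → Set ℓ} → Def e P → Def e Q → Def e (λ x → P x ⋆ Q x)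
      Def-binary {e = e} _⋆′_ ⋆-⇔ (definable φ p sat) (definable ψ q sat′) =
        let φ′ , eq  = Sat-vars (paramsˡ e p q) φ
            ψ′ , eq′ = Sat-vars (leftᵛ (all-vars {e = e}) ++ᵛ paramsʳ e p q) ψ
        in definable (φ′ ⋆′ ψ′) (p ++ q) λ x → ⋆-⇔ (⇔.trans (sat x) (eq x)) (⇔.trans (sat′ x) (eq′ x))

    module _ {X : Set x} {e : Context X n} {P Q : X → Set ℓ} where

      Def-× : Def e P → Def e Q → Def e (λ x → P x × Q x)
      Def-× = Def-binary _∧′_ _×-⇔_

      Def-→ : Def e P → Def e Q → Def e (λ x → P x → Q x)
      Def-→ = Def-binary _⇒′_ →-cong-⇔

    Def-⊤ : {e : Context X n} → Def e (λ _ → ⊤)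
    Def-⊤ = definable (⊥′ ⇒′ ⊥′) [] λ _ → mk⇔ (λ _ ()) _

    Def-¬ : {P : X → Set ℓ} → Def e P → Def e (λ x → ¬ P x)
    Def-¬ p = Def-cong (λ _ → mk⇔ (λ ¬p p → lift (¬p p)) (λ ¬p p → lower (¬p p)))
      (Def-→ p (definable ⊥′ [] λ _ → ⇔.refl))

    Def-⇔ : {P Q : X → Set ℓ} → Def e P → Def e Q → Def e (λ x → P x ⇔ Q x)
    Def-⇔ p q = Def-cong
      (λ _ → mk⇔ (λ eq → Equivalence.to eq , Equivalence.from eq) λ (to , from) → mk⇔ to from)
      (Def-× (Def-→ p q) (Def-→ q p))

    module _ {X : Set x} {e : Context X n} {P : X × C → Set ℓ} where

      Def-∃ : Def (e ▸) P → Def e (λ x → ∃ λ c → P (x , c))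
      Def-∃ (definable φ p sat) = definable (ex′ φ) p λ x → mk⇔
        (λ (c , pc) → c , Equivalence.to (sat (x , c)) pc)
        (λ (c , pc) → c , Equivalence.from (sat (x , c)) pc)

      Def-∀ : Def (e ▸) P → Def e (λ x → ∀ c → P (x , c))
      Def-∀ (definable φ p sat) = definable (all′ φ) p λ x → mk⇔
        (λ pc c → Equivalence.to (sat (x , c)) (pc c))
        (λ pc c → Equivalence.from (sat (x , c)) (pc c))

    -- Quantifies one coordinate at a time. It is what makes `Generic` definable, where a whole
    -- point of M^n is bound.
    Def-∀* : ∀ l {X : Set x} {e : Context X n} {P : X × Vec C l → Set ℓ} →
             Def (λ (x , a) → a ++ e x) P → Def e (λ x → ∀ a → P (x , a))
    Def-∀* zero p = Def-cong (λ _ → mk⇔ (λ f → f []) (λ { q [] → q })) (Def-reindex all-vars p)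
    Def-∀* (suc l) {e = e} p = Def-cong
      (λ _ → mk⇔ (λ f a c → f (c ∷ a)) (λ { f (c ∷ a) → f a c }))
      (Def-∀* l (Def-∀ (Def-reindex (all-vars {e = (λ (x , a) → a ++ e x) ▸}) p)))

  -- Definable subsets of the line

  module Tameness {s ℓ} {L : Language s} (M : Structure L ℓ) where
    open Structure M using (_<_; isDenseLinearOrder; no-least; no-greatest) renaming (Carrier to C)
    open IsDenseLinearOrder isDenseLinearOrder using (compare; irrefl; dense)
      renaming (trans to <-trans)
    open Definability M

    infix 4 _≤_
    _≤_ : C → C → Set ℓ
    c ≤ d = ¬ d < c

    <⇒≤ : ∀ {c d} → c < d → c ≤ d
    <⇒≤ c<d d<c = irrefl refl (<-trans c<d d<c)

    ≤-refl : ∀ {c} → c ≤ c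
    ≤-refl = irrefl refl

    <-≤-trans : ∀ {a b c} → a < b → b ≤ c → a < c
    <-≤-trans {a} {b} {c} a<b b≤c with compare b c
    ... | tri< b<c _ _  = <-trans a<b b<c
    ... | tri≈ _ refl _ = a<b
    ... | tri> _ _ c<b  = contradiction c<b b≤c

    ≤-<-trans : ∀ {a b c} → a ≤ b → b < c → a < c
    ≤-<-trans {a} {b} {c} a≤b b<c with compare a b
    ... | tri< a<b _ _  = <-trans a<b b<c
    ... | tri≈ _ refl _ = b<c
    ... | tri> _ _ b<a  = contradiction b<a a≤b

    ≤-trans : ∀ {a b c} → a ≤ b → b ≤ c → a ≤ c
    ≤-trans a≤b b≤c c<a = b≤c (<-≤-trans c<a a≤b)

    max< : ∀ {a b c} → a < c → b < c → ∃ λ d → d < c × a ≤ d × b ≤ d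
    max< {a} {b} a<c b<c with compare a b
    ... | tri< a<b _ _  = b , b<c , <⇒≤ a<b , ≤-refl
    ... | tri≈ _ refl _ = b , b<c , ≤-refl , ≤-refl
    ... | tri> _ _ b<a  = a , a<c , ≤-refl , <⇒≤ b<a

    min> : ∀ {a b c} → c < a → c < b → ∃ λ d → c < d × d ≤ a × d ≤ b
    min> {a} {b} c<a c<b with compare a b
    ... | tri< a<b _ _  = a , c<a , ≤-refl , <⇒≤ a<b
    ... | tri≈ _ refl _ = b , c<b , ≤-refl , ≤-refl
    ... | tri> _ _ b<a  = b , c<b , <⇒≤ b<a , ≤-refl

    -- Its negation says that `c` is a boundary point of `S` in the order topology.
    LocallyConstant : Pred C ℓ → Pred C ℓ
    LocallyConstant S c =
      ∃ λ u → ∃ λ v → u < c × c < v × (∀ d → u < d → d < v → S d ⇔ S c)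

    empty-locallyConstant : ∀ {S} → (∀ c → ¬ S c) → ∀ c → LocallyConstant S c
    empty-locallyConstant empty c with no-least c | no-greatest c
    ... | u , u<c | v , c<v = u , v , u<c , c<v , λ d _ _ →
      mk⇔ (λ p → contradiction p (empty d)) (λ p → contradiction p (empty c))

    Outside : C → C → Pred C ℓ
    Outside x y t = t < x ⊎ y < t

    -- This is the form in which o-minimality is used, with `T` the endpoints of the pieces. The
    -- closed interval from `x` to `y` has to avoid them.
    ConstantOff : List C → Pred C ℓ → Set ℓ
    ConstantOff T S = ∀ {x y} → x < y → All (Outside x y) T → S x ⇔ S y

    private
      ends : C ± → List C
      ends [ c ] = c ∷ []
      ends ⊥±    = []
      ends ⊤±    = []

      above-constant : ∀ a → ConstantOff (ends a) (λ x → _<±_ _<_ a [ x ])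
      above-constant ⊥±    {x} {y} _ _ = mk⇔ (λ _ → ⊥±<[ y ]) (λ _ → ⊥±<[ x ])
      above-constant ⊤±    _ _ = mk⇔ (λ ()) (λ ())
      above-constant [ a ] x<y (inj₁ a<x ∷ []) = mk⇔ (λ _ → [ <-trans a<x x<y ]) (λ _ → [ a<x ])
      above-constant [ a ] x<y (inj₂ y<a ∷ []) =
        mk⇔ (λ { [ a<x ] → ⊥-elim (<⇒≤ (<-trans a<x x<y) y<a) }) (λ { [ a<y ] → ⊥-elim (<⇒≤ a<y y<a) })

      below-constant : ∀ b → ConstantOff (ends b) (λ x → _<±_ _<_ [ x ] b)
      below-constant ⊥±    _ _ = mk⇔ (λ { Supremum.[ () ] }) (λ { Supremum.[ () ] })
      below-constant ⊤±    {x} {y} _ _ = mk⇔ (λ _ → [ y ]<⊤±) (λ _ → [ x ]<⊤±)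
      below-constant [ b ] x<y (inj₁ b<x ∷ []) =
        mk⇔ (λ { [ x<b ] → ⊥-elim (<⇒≤ x<b b<x) }) (λ { [ y<b ] → ⊥-elim (<⇒≤ (<-trans b<x x<y) y<b) })
      below-constant [ b ] x<y (inj₂ y<b ∷ []) = mk⇔ (λ _ → [ y<b ]) (λ _ → [ <-trans x<y y<b ])

      endpoints : Piece M → List C
      endpoints (point a)      = a ∷ []
      endpoints (interval a b) = ends a List.++ ends b

      piece-constant : ∀ p → ConstantOff (endpoints p) (⟦_⟧ M p)
      piece-constant (point a) x<y (inj₁ a<x ∷ []) = mk⇔
        (λ { refl → ⊥-elim (≤-refl a<x) }) (λ { refl → ⊥-elim (<⇒≤ a<x x<y) })
      piece-constant (point a) x<y (inj₂ y<a ∷ []) = mk⇔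
        (λ { refl → ⊥-elim (<⇒≤ x<y y<a) }) (λ { refl → ⊥-elim (≤-refl y<a) })
      piece-constant (interval a b) x<y out =
        above-constant a x<y (++⁻ˡ (ends a) out) ×-⇔ below-constant b x<y (++⁻ʳ (ends a) out)

      pieces-constant : ∀ ps → ConstantOff (concatMap endpoints ps) (λ x → Any (λ p → ⟦_⟧ M p x) ps)
      pieces-constant []       _   _   = mk⇔ (λ ()) (λ ())
      pieces-constant (p ∷ ps) x<y out = mk⇔
        (λ { (here xp) → here (to p₁ xp) ; (there xps) → there (to ps₁ xps) })
        (λ { (here yp) → here (from p₁ yp) ; (there yps) → there (from ps₁ yps) })
        where
        open Equivalence
        p₁  = piece-constant p x<y (++⁻ˡ (endpoints p) out)
        ps₁ = pieces-constant ps x<y (++⁻ʳ (endpoints p) out)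

      gap : ∀ T {c} → c ∉ˡ T → ∃ λ u → ∃ λ v → u < c × c < v × All (λ t → t ≤ u ⊎ v ≤ t) T
      gap [] {c} _ = let u , u<c = no-least c ; v , c<v = no-greatest c in u , v , u<c , c<v , []
      gap (t ∷ T) {c} c∉ with gap T (c∉ ∘ there) | compare t c
      ... | u , v , u<c , c<v , out | tri< t<c _ _ =
        let w , w<c , u≤w , t≤w = max< u<c t<c
        in w , v , w<c , c<v , inj₁ t≤w ∷ All.map
          (λ { (inj₁ t≤u) → inj₁ (≤-trans t≤u u≤w) ; (inj₂ v≤t) → inj₂ v≤t }) out
      ... | _ | tri≈ _ refl _ = contradiction (here refl) c∉
      ... | u , v , u<c , c<v , out | tri> _ _ c<t =
        let w , c<w , w≤v , w≤t = min> c<v c<t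
        in u , w , u<c , c<w , inj₂ w≤t ∷ All.map
          (λ { (inj₁ t≤u) → inj₁ t≤u ; (inj₂ v≤t) → inj₂ (≤-trans w≤v v≤t) }) out

    constantOff⇒locallyConstant : ∀ {T S} → ConstantOff T S → ∀ {c} → c ∉ˡ T → LocallyConstant S c
    constantOff⇒locallyConstant {T} {S} const {c} c∉T with gap T c∉T
    ... | u , v , u<c , c<v , out = u , v , u<c , c<v , around
      where
      around : ∀ d → u < d → d < v → S d ⇔ S c
      around d u<d d<v with compare d c
      ... | tri≈ _ refl _ = ⇔.refl
      ... | tri< d<c _ _  = const d<c (All.map
        (λ { (inj₁ t≤u) → inj₁ (≤-<-trans t≤u u<d) ; (inj₂ v≤t) → inj₂ (<-≤-trans c<v v≤t) }) out)
      ... | tri> _ _ c<d  = ⇔.sym (const c<d (All.map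
        (λ { (inj₁ t≤u) → inj₁ (≤-<-trans t≤u u<c) ; (inj₂ v≤t) → inj₂ (<-≤-trans d<v v≤t) }) out))

    -- The order of M need not be complete: connectedness of intervals is proved
    -- for sets that are constant off a finite set T, by induction on T.
    module _ {S : Pred C ℓ} where

      private
        connected′ : ∀ T {x y} → x < y → (∀ {z} → x ≤ z → z ≤ y → LocallyConstant S z) →
                     (∀ {z w} → x ≤ z → z < w → w ≤ y → All (Outside z w) T → S z ⇔ S w) → S x ⇔ S y
        connected′ [] x<y lc const = const ≤-refl x<y ≤-refl []
        connected′ (t ∷ T) {x} {y} x<y lc const with em {P = t < x} | em {P = y < t}
        ... | yes t<x | _ = connected′ T x<y lc λ x≤z z<w w≤y out →
          const x≤z z<w w≤y (inj₁ (<-≤-trans t<x x≤z) ∷ out)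
        ... | no _ | yes y<t = connected′ T x<y lc λ x≤z z<w w≤y out →
          const x≤z z<w w≤y (inj₂ (≤-<-trans w≤y y<t) ∷ out)
        -- Now `t` lies in the interval. Local constancy at `t` joins it to a point `w` on either
        -- side, and the part of the interval beyond `w` avoids `t`, so the induction applies there.
        ... | no x≤t | no t≤y with lc x≤t t≤y
        ...   | u , v , u<t , t<v , near = ⇔.trans below above
          where
          below : S x ⇔ S t
          below with compare x t
          ... | tri≈ _ refl _ = ⇔.refl
          ... | tri> _ _ t<x  = contradiction t<x x≤t
          ... | tri< x<t _ _  =
            let d , d<t , u≤d , x≤d = max< u<t x<t
                w , d<w , w<t = dense d<t
            in ⇔.trans
              (connected′ T (≤-<-trans x≤d d<w)
                (λ x≤z z≤w → lc x≤z (≤-trans (≤-trans z≤w (<⇒≤ w<t)) t≤y))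
                (λ x≤z z<z′ z′≤w out → const x≤z z<z′ (≤-trans (≤-trans z′≤w (<⇒≤ w<t)) t≤y)
                  (inj₂ (≤-<-trans z′≤w w<t) ∷ out)))
              (near w (≤-<-trans u≤d d<w) (<-trans w<t t<v))

          above : S t ⇔ S y
          above with compare t y
          ... | tri≈ _ refl _ = ⇔.refl
          ... | tri> _ _ y<t  = contradiction y<t t≤y
          ... | tri< t<y _ _  =
            let d , t<d , d≤v , d≤y = min> t<v t<y
                w , t<w , w<d = dense t<d
            in ⇔.trans
              (⇔.sym (near w (<-trans u<t t<w) (<-≤-trans w<d d≤v)))
              (connected′ T (<-≤-trans w<d d≤y)
                (λ w≤z z≤y → lc (≤-trans x≤t (≤-trans (<⇒≤ t<w) w≤z)) z≤y)
                (λ w≤z z<z′ z′≤y out → const (≤-trans x≤t (≤-trans (<⇒≤ t<w) w≤z)) z<z′ z′≤y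
                  (inj₁ (<-≤-trans t<w w≤z) ∷ out)))

      connected : ∀ {T x y} → ConstantOff T S → x < y →
                  (∀ {z} → ¬ z < x → ¬ y < z → LocallyConstant S z) → S x ⇔ S y
      connected {T} const x<y lc = connected′ T x<y lc λ _ z<w _ → const z<w

    -- A descending chain replaces counting: for each fixed number it is a first-order condition,
    -- which the definability of labels requires.
    AtLeast : Pred C ℓ → ℕ → Pred C ℓ
    AtLeast Z zero    c = ⊤
    AtLeast Z (suc i) c = ∃ λ z → z < c × Z z × AtLeast Z i z

    Exactly : Pred C ℓ → ℕ → Pred C ℓ
    Exactly Z i c = AtLeast Z i c × ¬ AtLeast Z (suc i) c

    module _ {Z : Pred C ℓ} where

      AtLeast-mono : ∀ i {c d} → c < d → AtLeast Z i c → AtLeast Z i d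
      AtLeast-mono zero    c<d _               = tt
      AtLeast-mono (suc i) c<d (z , z<c , rest) = z , <-trans z<c c<d , rest

      -- Induction on `n`. The chain descends strictly, so its top point `z` can be deleted from
      -- `T`, which makes the list shorter.
      AtLeast-bounded : ∀ n T {c} → length T ℕ.< n → (∀ {z} → z < c → Z z → z ∈ˡ T) → ¬ AtLeast Z n c
      AtLeast-bounded (suc n) T (ℕ.s≤s |T|≤n) Z⊆T (z , z<c , Zz , rest) =
        AtLeast-bounded n (filter (λ w → em {P = w ≢ z}) T)
          (ℕ.<-≤-trans (filter-notAll _ T (Any.map (λ z≡w w≢z → w≢z (sym z≡w)) (Z⊆T z<c Zz))) |T|≤n)
          (λ w<z Zw → ∈-filter⁺ _ (Z⊆T (<-trans w<z z<c) Zw) λ w≡z → irrefl w≡z w<z)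
          rest

      ∃-Exactly : ∀ T → (∀ {z} → Z z → z ∈ˡ T) → ∀ c → ∃ λ i → Exactly Z i c
      ∃-Exactly T Z⊆T c = search _ (AtLeast-bounded (suc (length T)) T ℕ.≤-refl (λ _ → Z⊆T))
        where
        search : ∀ n → ¬ AtLeast Z n c → ∃ λ i → Exactly Z i c
        search zero    ¬atLeast = contradiction tt ¬atLeast
        search (suc n) ¬atLeast with em {P = AtLeast Z n c}
        ... | yes atLeast  = n , atLeast , ¬atLeast
        ... | no ¬atLeast′ = search n ¬atLeast′

      -- If `c < d`, then `c` and the `i` points below it are `suc i` points below `d`.
      Exactly-unique : ∀ {i c d} → Z c → Z d → Exactly Z i c → Exactly Z i d → c ≡ d
      Exactly-unique {c = c} {d} Zc Zd (≥c , ¬>c) (≥d , ¬>d) with compare c d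
      ... | tri< c<d _ _ = contradiction (c , c<d , Zc , ≥c) ¬>d
      ... | tri≈ _ eq _  = eq
      ... | tri> _ _ d<c = contradiction (d , d<c , Zd , ≥d) ¬>c

      -- A point of `Z` strictly between `c` and `d`, on top of the `i` points below `c`, would give
      -- `suc i` points below `d`.
      Exactly-gap : ∀ {i c d z} → Exactly Z i c → Exactly Z i d → ¬ Z c → ¬ Z d → c ≤ z → z ≤ d → ¬ Z z
      Exactly-gap {i} {c} {d} {z} (≥c , _) (_ , ¬>d) ¬Zc ¬Zd c≤z z≤d Zz with compare c z | compare z d
      ... | tri≈ _ refl _ | _             = ¬Zc Zz
      ... | tri> _ _ z<c  | _             = c≤z z<c
      ... | _             | tri≈ _ refl _ = ¬Zd Zz
      ... | _             | tri> _ _ d<z  = z≤d d<z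
      ... | tri< c<z _ _  | tri< z<d _ _  = ¬>d (z , z<d , Zz , AtLeast-mono i c<z ≥c)

    private
      variable
        x y : Level
        X : Set x
        m n : ℕ

    module _ {X : Set x} {e : Context X n} {S : X → Pred C ℓ}
      (defS : Def (e ▸) (λ (x , c) → S x c)) where

      private
        at : {Y : Set y} {f : Context Y m} {g : Y → X} {t : Y → C} →
             Var f t → Vars f (e ∘ g) → Def f (λ y → S (g y) (t y))
        at t g = Def-reindex (t ∷ᵛ g) defS

      Def-locallyConstant : Def (e ▸) (λ (x , c) → LocallyConstant (S x) c)
      Def-locallyConstant = Def-∃ (Def-∃
        (Def-× (Def-< u c) (Def-× (Def-< c v)
          (Def-∀ (Def-→ (Def-< (older u) d) (Def-→ (Def-< d (older v))
            (Def-⇔ (at d xs) (at (older c) xs))))))))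
        where
        u = older newest
        v = newest
        c = older (older newest)
        d = newest
        xs = olders (olders (olders (olders (all-vars {e = e}))))

      Def-AtLeast : ∀ i → Def (e ▸) (λ (x , c) → AtLeast (S x) i c)
      Def-AtLeast zero    = Def-⊤
      Def-AtLeast (suc i) = Def-∃ (Def-× (Def-< newest (older newest))
        (Def-× (at newest xs) (Def-reindex (newest ∷ᵛ xs) (Def-AtLeast i))))
        where
        xs = olders (olders (all-vars {e = e}))

      Def-Exactly : ∀ i → Def (e ▸) (λ (x , c) → Exactly (S x) i c)
      Def-Exactly i = Def-× (Def-AtLeast i) (Def-¬ (Def-AtLeast (suc i)))

      module _ (om : OMinimal M) where

        ∃-constantOff : ∀ x → ∃ λ T → ConstantOff T (S x)
        ∃-constantOff x =
          let definable φ p sat = defS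
              -- The values `e x` of the context become parameters next to `p`, which leaves one
              -- free variable.
              ps , S⇔ps = om (S x ∘ Vec.head) (_ , φ , e x ++ p , λ { (c ∷ []) → sat (x , c) })
          in concatMap endpoints ps , λ {c} {d} c<d out →
            ⇔.trans (S⇔ps c) (⇔.trans (pieces-constant ps c<d out) (⇔.sym (S⇔ps d)))

        ∃-Exactly-jumps : ∀ x c → ∃ λ i → Exactly (λ c → ¬ LocallyConstant (S x) c) i c
        ∃-Exactly-jumps x = let T , const = ∃-constantOff x in
          ∃-Exactly T λ jump → decidable-stable em λ z∉T → jump (constantOff⇒locallyConstant const z∉T)

  -- Coding the members of a definable family

  module Coding {s ℓ} {L : Language s} (M : Structure L ℓ) (om : OMinimal M)
    {n} (A : Pred (Vec (Structure.Carrier M) n) ℓ) where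
    open Structure M using (_<_; isDenseLinearOrder; no-least; no-greatest) renaming (Carrier to C)
    open IsDenseLinearOrder isDenseLinearOrder using (compare)
    open Definability M
    open Tameness M

    -- Boolean membership has unique proofs, so `_≡_` on this type compares only the underlying
    -- tuples, as `Elements` does.
    Member : Set ℓ
    Member = ∃ λ x → x ∈ ⟨ A ⟩

    Member-≡ : {a b : Member} → proj₁ a ≡ proj₁ b → a ≡ b
    Member-≡ {a = x , p} {_ , q} refl = cong (x ,_) (T-irrelevant p q)

    Label : Set ℓ
    Label = (Member × ℕ) ⊎ ℕ ⊎ ℕ

    DefFamily : ∀ {m} → (Vec C n → Vec C m → Set ℓ) → Set (s ⊔ ℓ)
    DefFamily {m} P = Def {X = Vec C n × Vec C m} (λ (x , b) → x ++ b) (λ (x , b) → P x b)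

    -- The labels of c: the i-th jump of { c ∣ P a (c ∷ b) }, the i-th jump of the
    -- set of generic points, and a generic point preceded by i jumps of that set.
    -- Indices start from 0.
    module _ {m} (P : Vec C n → Vec C (suc m) → Set ℓ) (P⊆A : ∀ {x b} → P x b → A x)
      (defP : DefFamily P) where

      private
        Slice : Vec C n → Vec C m → Pred C ℓ
        Slice a b c = P a (c ∷ b)

        Generic : Vec C m → Pred C ℓ
        Generic b c = ∀ a → LocallyConstant (Slice a b) c

        Jump : (Vec C m → Pred C ℓ) → Vec C m → Pred C ℓ
        Jump S b c = ¬ LocallyConstant (S b) c

        Labelled : Label → Vec C m → Pred C ℓ
        Labelled (inj₁ ((a , _) , i)) b c = Jump (Slice a) b c × Exactly (Jump (Slice a) b) i c
        Labelled (inj₂ (inj₁ i))      b c = Jump Generic b c × Exactly (Jump Generic b) i c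
        Labelled (inj₂ (inj₂ i))      b c =
          Generic b c × ¬ Jump Generic b c × Exactly (Jump Generic b) i c

        params : Context (Vec C m) m
        params = id

        def-slice : ∀ a → Def (params ▸) (λ (b , c) → Slice a b c)
        def-slice a = Def-specialise {g = λ (b , c) → a , c ∷ b} a
          (rightᵛ {e = params ▸} (all-vars {e = λ _ → a}) ++ᵛ leftᵛ (all-vars {e = params ▸})) defP

        def-generic : Def (params ▸) (λ (b , c) → Generic b c)
        def-generic = Def-∀* n (Def-reindex
          {f = (λ (b , a) → a ++ b) ▸} {g = λ ((b , c) , a) → (b , a) , c}
          (coordinate cb Fin.zero ∷ᵛ (leftᵛ (all-vars {e = proj₂}) ++ᵛ variables (coordinate cb ∘ Fin.suc)))
          (Def-locallyConstant (Def-reindex {g = λ ((b , a) , c) → a , c ∷ b}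
            (olders (leftᵛ (all-vars {e = proj₂})) ++ᵛ
             newest ∷ᵛ olders (rightᵛ {e = proj₂} (all-vars {e = proj₁})))
            defP)))
          where
          cb = rightᵛ {e = proj₂} (all-vars {e = (params ▸) ∘ proj₁})

        def-jump : ∀ {S} → Def (params ▸) (λ (b , c) → S b c) → Def (params ▸) (λ (b , c) → Jump S b c)
        def-jump defS = Def-¬ (Def-locallyConstant defS)

        -- The label is fixed: its point `a` enters through the parameters, its index `i` through
        -- the shape of the formula.
        def-labelled : ∀ j → Def (params ▸) (λ (b , c) → Labelled j b c)
        def-labelled (inj₁ ((a , _) , i)) =
          Def-× (def-jump (def-slice a)) (Def-Exactly (def-jump (def-slice a)) i)
        def-labelled (inj₂ (inj₁ i)) = Def-× (def-jump def-generic) (Def-Exactly (def-jump def-generic) i)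
        def-labelled (inj₂ (inj₂ i)) =
          Def-× def-generic (Def-× (Def-¬ (def-jump def-generic)) (Def-Exactly (def-jump def-generic) i))

        -- Outside `A` the slices are empty and have no boundary points. Hence labels need only
        -- points of `A`, although `Generic` quantifies over M^n.
        jump⇒A : ∀ a {b c} → Jump (Slice a) b c → A a
        jump⇒A a {c = c} jump = decidable-stable em λ a∉A →
          jump (empty-locallyConstant (λ _ p → a∉A (P⊆A p)) c)

        label : ∀ b c → ∃ λ j → Labelled j b c
        label b c = go em em
          where
          go : Dec (∃ λ a → Jump (Slice a) b c) → Dec (Jump Generic b c) → ∃ λ j → Labelled j b c
          go (yes (a , jump)) _ =
            let i , exactly = ∃-Exactly-jumps (def-slice a) om b c
            in inj₁ ((a , ⇒∈ (jump⇒A a jump)) , i) , jump , exactly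
          go (no ¬jump) d =
            let i , exactly = ∃-Exactly-jumps def-generic om b c
                generic     = λ a → decidable-stable em λ jump → ¬jump (a , jump)
            in case d of λ
              { (yes jump) → inj₂ (inj₁ i) , jump , exactly
              ; (no ¬jump) → inj₂ (inj₂ i) , generic , ¬jump , exactly
              }

        -- Connectedness is used twice. No jump of the generic set lies between `c` and `d`, as both
        -- are preceded by `i` jumps, so all points between are generic. Then every slice is locally
        -- constant there, hence constant.
        generic-constant : ∀ {i b c d} → Labelled (inj₂ (inj₂ i)) b c → Labelled (inj₂ (inj₂ i)) b d →
                           c < d → ∀ x → P x (c ∷ b) ⇔ P x (d ∷ b)
        generic-constant {i} {b} {c} {d} (gen-c , ¬jump-c , exactly-c) (_ , ¬jump-d , exactly-d) c<d x =
          connected (proj₂ (∃-constantOff (def-slice x) om b)) c<d λ c≤z z≤d → generic c≤z z≤d x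
          where
          const = proj₂ (∃-constantOff def-generic om b)

          smooth : ∀ {z} → ¬ z < c → ¬ d < z → LocallyConstant (Generic b) z
          smooth c≤z z≤d = decidable-stable em (Exactly-gap exactly-c exactly-d ¬jump-c ¬jump-d c≤z z≤d)

          generic : ∀ {z} → ¬ z < c → ¬ d < z → Generic b z
          generic {z} c≤z z≤d with compare c z
          ... | tri≈ _ refl _ = gen-c
          ... | tri> _ _ z<c  = contradiction z<c c≤z
          ... | tri< c<z _ _  = Equivalence.to (connected const c<z λ {w} c≤w w≤z →
            smooth c≤w λ d<w → w≤z (≤-<-trans z≤d d<w)) gen-c

        -- For the two kinds of label that name a jump, the label determines the point outright.
        labelled-constant : ∀ j {b c d} → Labelled j b c → Labelled j b d → ∀ x → P x (c ∷ b) ⇔ P x (d ∷ b)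
        labelled-constant (inj₁ ((a , _) , i)) (jump-c , exactly-c) (jump-d , exactly-d) x
          with refl ← Exactly-unique {i = i} jump-c jump-d exactly-c exactly-d = ⇔.refl
        labelled-constant (inj₂ (inj₁ i)) (jump-c , exactly-c) (jump-d , exactly-d) x
          with refl ← Exactly-unique {i = i} jump-c jump-d exactly-c exactly-d = ⇔.refl
        labelled-constant (inj₂ (inj₂ i)) {c = c} {d} lc ld x with compare c d
        ... | tri< c<d _ _  = generic-constant {i} lc ld c<d x
        ... | tri≈ _ refl _ = ⇔.refl
        ... | tri> _ _ d<c  = ⇔.sym (generic-constant {i} ld lc d<c x)

      -- Quantifying `c` away keeps the family definable with one parameter fewer. By
      -- `labelled-constant` all `c` with the same label give the same set, so nothing is merged.
      Fibre : Label → Vec C n → Vec C m → Set ℓ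
      Fibre j x b = ∃ λ c → Labelled j b c × P x (c ∷ b)

      def-fibre : ∀ j → DefFamily (Fibre j)
      def-fibre j = Def-∃ (Def-×
        (Def-reindex {f = params ▸} {g = λ ((x , b) , c) → b , c} (newest ∷ᵛ olders bs) (def-labelled j))
        (Def-reindex {g = λ ((x , b) , c) → x , c ∷ b}
          (olders (leftᵛ (all-vars {e = proj₁})) ++ᵛ newest ∷ᵛ olders bs) defP))
        where
        bs = rightᵛ {e = proj₁} (all-vars {e = proj₂})

      label-of : C → Vec C m → Label
      label-of c b = proj₁ (label b c)

      fibre⇔ : ∀ c b x → P x (c ∷ b) ⇔ Fibre (label-of c b) x b
      fibre⇔ c b x = mk⇔
        (λ p → c , proj₂ (label b c) , p)
        (λ (d , labelled , p) →
          Equivalence.from (labelled-constant (label-of c b) (proj₂ (label b c)) labelled x) p)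

    Code : ∀ {m} → (Vec C n → Vec C m → Set ℓ) → Set ℓ
    Code {m} P = ∃ λ (code : Vec C m → List Label) →
      ∀ {b b′} → code b ≡ code b′ → ∀ x → P x b ⇔ P x b′

    -- Induction on `m` for all definable families at once: the first entry of the tuple is replaced
    -- by its label `j`, and the rest is coded in the family `Fibre j`.
    encode-family : ∀ m (P : Vec C n → Vec C m → Set ℓ) → (∀ {x b} → P x b → A x) →
                    DefFamily P → Code P
    encode-family zero    P P⊆A defP = (λ _ → []) , λ { {[]} {[]} _ x → ⇔.refl }
    encode-family (suc m) P P⊆A defP = code , λ { {c ∷ b} {c′ ∷ b′} eq x →
        let j≡ , code≡ = ∷-injective eq in
        ⇔.trans (fibre⇔ P P⊆A defP c b x)
          (⇔.trans (same j≡ code≡ x) (⇔.sym (fibre⇔ P P⊆A defP c′ b′ x))) }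
      where
      F = Fibre P P⊆A defP

      rec : ∀ j → Code (F j)
      rec j = encode-family m (F j) (λ (_ , _ , p) → P⊆A p) (def-fibre P P⊆A defP j)

      code : Vec C (suc m) → List Label
      code (c ∷ b) = let j = label-of P P⊆A defP c b in j ∷ proj₁ (rec j) b

      -- The heads must be identified first, since the tails are codes in families that depend on
      -- them.
      same : ∀ {j j′ b b′} → j ≡ j′ → proj₁ (rec j) b ≡ proj₁ (rec j′) b′ → ∀ x → F j x b ⇔ F j′ x b′
      same refl = proj₂ (rec _)

  -- Sequences of distinct elements in an infinite type

  module _ {a} {Y : Set a} (infinite : ¬ ∃ λ ys → ∀ (y : Y) → y ∈ˡ ys) where

    private
      fresh : ∀ ys → ∃ λ y → y ∉ˡ ys
      fresh ys = ¬∀⇒∃¬ λ all → infinite (ys , all)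

      prefix : ℕ → List Y
      prefix zero    = []
      prefix (suc n) = proj₁ (fresh (prefix n)) ∷ prefix n

    sequence : ℕ → Y
    sequence n = proj₁ (fresh (prefix n))

    private
      earlier : ∀ {m n} → m ℕ.< n → sequence m ∈ˡ prefix n
      earlier {m} {suc n} (ℕ.s≤s m≤n) with ℕ.m≤n⇒m<n∨m≡n m≤n
      ... | inj₁ m<n  = there (earlier m<n)
      ... | inj₂ refl = here refl

      distinct : ∀ {m n} → m ℕ.< n → sequence m ≢ sequence n
      distinct {n = n} m<n eq = proj₂ (fresh (prefix n)) (subst (_∈ˡ prefix n) eq (earlier m<n))

    sequence-injective : Injective _≡_ _≡_ sequence
    sequence-injective {m} {n} eq with ℕ.<-cmp m n
    ... | tri< m<n _ _ = contradiction eq (distinct m<n)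
    ... | tri≈ _ m≡n _ = m≡n
    ... | tri> _ _ n<m = contradiction (sym eq) (distinct n<m)

  -- Comparing the definable basis with A

  module _ {s ℓ} {L : Language s} (M : Structure L ℓ) (om : OMinimal M)
    {n} (A : Pred (Vec (Structure.Carrier M) n) ℓ) (infinite : Infinite A) where
    open Structure M using () renaming (Carrier to C)
    open Definability M
    open Coding M om A

    private
      members-infinite : ¬ ∃ λ as → ∀ (a : Member) → a ∈ˡ as
      members-infinite (as , all) = infinite (map proj₁ as , λ {x} x∈A → ∈-map⁺ proj₁ (all (x , ⇒∈ x∈A)))

      ν : ℕ → Member
      ν = sequence members-infinite

      ν-injective : Injective _≡_ _≡_ ν
      ν-injective = sequence-injective members-infinite

      lists = List-embeds ν ν-injective

      -- The three kinds of label are told apart by the lengths 2, 1 and 3.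
      spell : Label → List Member
      spell (inj₁ (a , i))  = a ∷ ν i ∷ []
      spell (inj₂ (inj₁ i)) = ν i ∷ []
      spell (inj₂ (inj₂ i)) = ν i ∷ ν i ∷ ν i ∷ []

      spell-injective : Injective _≡_ _≡_ spell
      spell-injective {inj₁ (a , i)} {inj₁ (b , j)} eq =
        cong₂ (λ a i → inj₁ (a , i)) (∷-injectiveˡ eq) (ν-injective (∷-injectiveˡ (∷-injectiveʳ eq)))
      spell-injective {inj₁ _} {inj₂ (inj₁ _)} ()
      spell-injective {inj₁ _} {inj₂ (inj₂ _)} ()
      spell-injective {inj₂ (inj₁ _)} {inj₁ _} ()
      spell-injective {inj₂ (inj₁ _)} {inj₂ (inj₂ _)} ()
      spell-injective {inj₂ (inj₂ _)} {inj₁ _} ()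
      spell-injective {inj₂ (inj₂ _)} {inj₂ (inj₁ _)} ()
      spell-injective {inj₂ (inj₁ i)} {inj₂ (inj₁ j)} eq = cong (inj₂ ∘ inj₁) (ν-injective (∷-injectiveˡ eq))
      spell-injective {inj₂ (inj₂ i)} {inj₂ (inj₂ j)} eq = cong (inj₂ ∘ inj₂) (ν-injective (∷-injectiveˡ eq))

      -- The embedding of lists is applied twice: to the spelling of each label, and to the
      -- resulting list.
      collapse : List Label → Member
      collapse = proj₁ lists ∘ map (proj₁ lists ∘ spell)

      collapse-injective : Injective _≡_ _≡_ collapse
      collapse-injective eq = map-injective (λ eq → spell-injective (proj₂ lists eq)) (proj₂ lists eq)

    module _ {m} (φ : Formula L (n + m)) (B : Pred (Vec C m) ℓ) (defA : Definable M A) where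

      private
        D : Vec C n → Vec C m → Set ℓ
        D x b = A x × Sat M φ (x ++ b)

        def-D : DefFamily D
        def-D = let k , ψ , p , A⇔ = defA ; φ′ , sat = Sat-vars (leftᵛ {f = λ _ → []} all-vars) φ in
          Def-× (Def-reindex {f = id} (leftᵛ all-vars) (definable ψ p A⇔)) (definable φ′ [] sat)

        encoding : Code D
        encoding = encode-family m D proj₁ def-D

        code = proj₁ encoding

        Parameter : Pred (Subset (Vec C n)) ℓ
        Parameter χ = ∃ λ b → χ ≡ ⟨ (λ x → D x b) ⟩

        -- Injections of setoids have to respect equality of subsets, so the parameter
        -- is chosen from the characteristic function and not from the given b ∈ B.
        name : ∀ χ → Dec (Parameter χ) → Member
        name χ (yes (b , _)) = collapse (code b)
        -- Not reached for members of the family, by `parameter`.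
        name χ (no _)        = ν 0

        name-injective : ∀ {χ ψ} → Parameter χ → Parameter ψ → ∀ d e → name χ d ≡ name ψ e → χ ≡ ψ
        name-injective χ∈ ψ∈ (no ¬χ) _ _ = contradiction χ∈ ¬χ
        name-injective χ∈ ψ∈ _ (no ¬ψ) _ = contradiction ψ∈ ¬ψ
        name-injective _ _ (yes (b , refl)) (yes (c , refl)) eq =
          let D⇔ = proj₂ encoding (collapse-injective eq)
          in ⟨⟩-cong (Equivalence.to (D⇔ _)) (Equivalence.from (D⇔ _))

        parameter : ∀ {U} → family M A φ B U → Parameter ⟨ U ⟩
        parameter (b , _ , U⊆D , D⊆U) = b , ⟨⟩-cong U⊆D D⊆U

      family-≼ : Members (family M A φ B) ≼ Elements A
      family-≼ = record
        { to        = λ (U , _) → let x , x∈ = name ⟨ U ⟩ em in x , ∈⇒ x∈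
        ; cong      = λ (U⊆V , V⊆U) → cong (λ χ → proj₁ (name χ em)) (⟨⟩-cong U⊆V V⊆U)
        ; injective = λ { {U , U∈} {V , V∈} eq →
            let U≡V = name-injective (parameter U∈) (parameter V∈) em em (Member-≡ eq)
            in (λ {x} p → ∈⇒ (subst (x ∈_) U≡V (⇒∈ p))) , λ {x} p → ∈⇒ (subst (x ∈_) (sym U≡V) (⇒∈ p)) }
        }

corollary2 : (∀ ℓ → ExcludedMiddle ℓ) → (∀ a b → Extensionality a b) →
    ∀ {s ℓ} {L : Language s} (M : Structure L ℓ) → OMinimal M →
    ∀ n (A : Pred (Vec (Structure.Carrier M) n) ℓ) (τ : Topology A) →
    DefinableSpace M τ → Infinite A → WeightAtMost τ (Elements A)
corollary2 EM FE M om n A τ (A-definable , m , φ , B , _ , basis) infinite =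
  -- The index type consists of all bases, and the definable one shows it to be inhabited. A basis
  -- of least cardinality realises the weight and injects into the definable basis, hence into `A`.
  let (𝓑 , 𝓑-basis) , least = least-cardinal EM FE (_ , basis) (λ (𝓑 , _) → Members 𝓑)
  in Members 𝓑 ,
     ((𝓑 , 𝓑-basis , Identity.bijection _) , λ 𝓑′ 𝓑′-basis → least (𝓑′ , 𝓑′-basis)) ,
     Composition.injection (least (_ , basis)) (family-≼ EM FE M om A infinite φ B A-definable)
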